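{- Let $N\ge2$ be an integer and $x\in[0,1]\setminus\mathbb{Q}$. Then: (1) $\widehat\omega(x,N)$ is not $1$-balanced. (2) $\omega(x,N)$ is not $(2N-1)$-balanced.
   Context: Let $N\ge 1$ be an integer and define $T_N:[0,1]\to[0,1]$ by $T_N(x)=\frac{N}{x}-\lfloor\frac{N}{x}\rfloor$ for $x\ne0$ and $T_N(0)=0$. For $x\in[0,1]\setminus\mathbb{Q}$ the (greedy) NCF digits of $x$ are $d_n=\lfloor N/T_N^{n-1}(x)\rfloor\ge N$, $n\ge1$; one writes $x=[0;d_1,d_2,\ldots]_N$. A substitution on $\{0,1\}$ is given by images of the letters (nonempty words) and extends to finite and infinite words by concatenation. For $x=[0;d_1,d_2,\ldots]_N$ irrational let $\sigma_n(0)=0^{d_n}1^N$, $\sigma_n(1)=0$ and $\widehat\sigma_n(0)=0^{d_n}1$, $\widehat\sigma_n(1)=0^N$ for $n\ge1$. The NCF sequence $\omega(x,N)\in\{0,1\}^{\mathbb N}$ is the unique infinite word $\omega$ for which there exist $\omega^{(1)},\omega^{(2)},\ldots\in\{0,1\}^{\mathbb{N}}$ with $\omega^{(1)}=\omega$ and $\omega^{(n)}=\sigma_n(\omega^{(n+1)})$ for all $n\ge1$. The dual NCF sequence $\widehat\omega(x,N)$ is defined in the same way with $\widehat\sigma_n$ in place of $\sigma_n$. For a finite word $u$, $|u|$ is its length and $|u|_a$ the number of occurrences of the letter $a$ in $u$. A sequence $\nu\in\{0,1\}^{\mathbb{N}}$ is $C$-balanced ($C>0$) if for all finite factors (contiguous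 subwords) $u,v$ of $\nu$ with $|u|=|v|$ one has $-C\le|u|_a-|v|_a\le C$ for every letter $a$. -}

module Defs where

open import Data.Empty using (⊥; ⊥-elim)
open import Data.Fin.Base using (Fin)
open import Data.Fin.Patterns using (0F; 1F)
open import Data.Fin.Properties using (_≟_)
open import Data.Integer.Base as ℤ using (+_)
import Data.Integer.Properties as ℤ
open import Data.List.Base as List using (List; []; _∷_; length; filter; applyUpTo)
open import Data.List.NonEmpty.Base as List⁺ using (List⁺; _∷_; _++⁺_; [_])
open import Data.Nat.Base as ℕ using (ℕ; zero; suc)
import Data.Nat.Properties as ℕ
open import Data.Product.Base using (∃; _×_; _,_; proj₁; proj₂)
open import Data.Rational.Base as ℚ using (ℚ; 0ℚ; 1ℚ; positive)
open import Data.Rational.Literals using (fromℤ)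
import Data.Rational.Properties as ℚ
open import Data.Sum.Base using (_⊎_; inj₁; inj₂; swap)
import Data.Sum.Base as Sum
open import Function.Base using (_∘_)
open import Relation.Binary.PropositionalEquality using (_≡_; _≗_; refl; sym; trans; cong; subst; subst₂)
open import Relation.Nullary using (¬_; yes; no)

-- Two-sided Dedekind reals; q ∈ L means q < x and q ∈ U means x < q.

record ℝ : Set₁ where
  field
    L U         : ℚ → Set
    L-inhabited : ∃ L
    U-inhabited : ∃ U
    L-lower     : ∀ {q r} → q ℚ.< r → L r → L q
    U-upper     : ∀ {q r} → q ℚ.< r → U q → U r
    L-open      : ∀ {q} → L q → ∃ λ r → q ℚ.< r × L r
    U-open      : ∀ {r} → U r → ∃ λ q → q ℚ.< r × U q
    disjoint    : ∀ {q} → L q → U q → ⊥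
    located     : ∀ {q r} → q ℚ.< r → L q ⊎ U r

open ℝ

infix 4 _<_ _≤_ _#_

_<_ : ℝ → ℝ → Set
x < y = ∃ λ q → U x q × L y q

_≤_ : ℝ → ℝ → Set
x ≤ y = ¬ (y < x)

_#_ : ℝ → ℝ → Set
x # y = x < y ⊎ y < x

fromℚ : ℚ → ℝ
fromℚ p = record
  { L           = ℚ._< p
  ; U           = p ℚ.<_
  ; L-inhabited = p ℚ.- 1ℚ , subst (p ℚ.- 1ℚ ℚ.<_) (ℚ.+-identityʳ p) (ℚ.+-monoʳ-< p (ℚ.negative⁻¹ (ℚ.- 1ℚ)))
  ; U-inhabited = p ℚ.+ 1ℚ , subst (ℚ._< p ℚ.+ 1ℚ) (ℚ.+-identityʳ p) (ℚ.+-monoʳ-< p (ℚ.positive⁻¹ 1ℚ))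
  ; L-lower     = ℚ.<-trans
  ; U-upper     = λ q<r p<q → ℚ.<-trans p<q q<r
  ; L-open      = λ q<p → let (m , q<m , m<p) = ℚ.<-dense q<p in m , q<m , m<p
  ; U-open      = λ p<r → let (m , p<m , m<r) = ℚ.<-dense p<r in m , m<r , p<m
  ; disjoint    = ℚ.<-asym
  ; located     = loc
  }
  where
  loc : ∀ {q r} → q ℚ.< r → q ℚ.< p ⊎ p ℚ.< r
  loc {q} q<r with q ℚ.<? p
  ... | yes q<p = inj₁ q<p
  ... | no  q≮p = inj₂ (ℚ.≤-<-trans (ℚ.≮⇒≥ q≮p) q<r)

fromℕ : ℕ → ℝ
fromℕ n = fromℚ (fromℤ (+ n))

0ℝ 1ℝ : ℝ
0ℝ = fromℕ 0
1ℝ = fromℕ 1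

-- Apartness from every rational, the constructive form of x ∉ ℚ; classically
-- it is the same as being different from every rational.

Irrational : ℝ → Set
Irrational x = ∀ q → x # fromℚ q

module _ (x : ℝ) where

  <⇒L : ∀ {q} → fromℚ q < x → L x q
  <⇒L (_ , q<r , r∈L) = L-lower x q<r r∈L

  <⇒U : ∀ {q} → x < fromℚ q → U x q
  <⇒U (_ , r∈U , r<q) = U-upper x r<q r∈U

  L⇒< : ∀ {q} → L x q → fromℚ q < x
  L⇒< = L-open x

  U⇒< : ∀ {q} → U x q → x < fromℚ q
  U⇒< q∈U = let (r , r<q , r∈U) = U-open x q∈U in r , r∈U , r<q

  L<U : ∀ {q r} → L x q → U x r → q ℚ.< r
  L<U {q} {r} q∈L r∈U with q ℚ.<? r
  ... | yes q<r = q<r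
  ... | no  q≮r = let (s , s<r , s∈U) = U-open x r∈U in
    ⊥-elim (disjoint x q∈L (U-upper x (ℚ.<-≤-trans s<r (ℚ.≮⇒≥ q≮r)) s∈U))

module _ {r : ℚ} (0<r : 0ℚ ℚ.< r) where

  private instance
    r-positive    = positive 0<r
    r-nonNegative = ℚ.pos⇒nonNeg r
    r-nonZero     = ℚ.pos⇒nonZero r

  *-monoˡ-< : ∀ {p q} → p ℚ.< q → p ℚ.* r ℚ.< q ℚ.* r
  *-monoˡ-< = ℚ.*-monoˡ-<-pos r

  *-monoʳ-< : ∀ {p q} → p ℚ.< q → r ℚ.* p ℚ.< r ℚ.* q
  *-monoʳ-< = ℚ.*-monoʳ-<-pos r

  *-monoˡ-≤ : ∀ {p q} → p ℚ.≤ q → p ℚ.* r ℚ.≤ q ℚ.* r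
  *-monoˡ-≤ = ℚ.*-monoʳ-≤-nonNeg r

  *-cancelʳ-< : ∀ {p q} → p ℚ.* r ℚ.< q ℚ.* r → p ℚ.< q
  *-cancelʳ-< = ℚ.*-cancelʳ-<-nonNeg r

  quotient : ∀ s → ∃ λ t → t ℚ.* r ≡ s
  quotient s = s ℚ.* ℚ.1/ r ,
    trans (ℚ.*-assoc s (ℚ.1/ r) r)
      (trans (cong (s ℚ.*_) (ℚ.*-inverseˡ r)) (ℚ.*-identityʳ s))

  quotient-pos : ∀ {t s} → t ℚ.* r ≡ s → 0ℚ ℚ.< s → 0ℚ ℚ.< t
  quotient-pos eq 0<s = *-cancelʳ-< (subst₂ ℚ._<_ (sym (ℚ.*-zeroˡ r)) (sym eq) 0<s)

-- The quotient p/x for rational p > 0 and real x > 0, by the cut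
-- q < p/x iff qr < p for some r > x, and p/x < q iff p < qr for some 0 < r < x.

module Division {p : ℚ} (0<p : 0ℚ ℚ.< p) (x : ℝ) (0<x : 0ℝ < x) where

  private
    0∈L : L x 0ℚ
    0∈L = <⇒L x 0<x

    U-pos : ∀ {r} → U x r → 0ℚ ℚ.< r
    U-pos = L<U x 0∈L

  quotL quotU : ℚ → Set
  quotL q = ∃ λ r → U x r × q ℚ.* r ℚ.< p
  quotU q = ∃ λ r → L x r × 0ℚ ℚ.< r × p ℚ.< q ℚ.* r

  quotL-≤0 : ∀ {q} → q ℚ.≤ 0ℚ → quotL q
  quotL-≤0 {q} q≤0 = let (r , r∈U) = U-inhabited x in
    r , r∈U , ℚ.≤-<-trans (subst (q ℚ.* r ℚ.≤_) (ℚ.*-zeroˡ r) (*-monoˡ-≤ (U-pos r∈U) q≤0)) 0<p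

  quotL-open : ∀ {q} → quotL q → ∃ λ q′ → q ℚ.< q′ × quotL q′
  quotL-open {q} (r , r∈U , qr<p) =
    let (s , qr<s , s<p) = ℚ.<-dense qr<p
        (t , tr≡s)       = quotient (U-pos r∈U) s
    in t , *-cancelʳ-< (U-pos r∈U) (subst (q ℚ.* r ℚ.<_) (sym tr≡s) qr<s)
         , r , r∈U , subst (ℚ._< p) (sym tr≡s) s<p

  quotU-open : ∀ {q} → quotU q → ∃ λ q′ → q′ ℚ.< q × quotU q′
  quotU-open {q} (r , r∈L , 0<r , p<qr) =
    let (s , p<s , s<qr) = ℚ.<-dense p<qr
        (t , tr≡s)       = quotient 0<r s
    in t , *-cancelʳ-< 0<r (subst (ℚ._< q ℚ.* r) (sym tr≡s) s<qr)
         , r , r∈L , 0<r , subst (p ℚ.<_) (sym tr≡s) p<s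

  quotU-inhabited : ∃ quotU
  quotU-inhabited =
    let (r , 0<r , r∈L) = L-open x 0∈L
        (t , tr≡2p)     = quotient 0<r (p ℚ.+ p)
    in t , r , r∈L , 0<r ,
       subst₂ ℚ._<_ (ℚ.+-identityʳ p) (sym tr≡2p) (ℚ.+-monoʳ-< p 0<p)

  quot-disjoint : ∀ {q} → quotL q → quotU q → ⊥
  quot-disjoint {q} (r , r∈U , qr<p) (s , s∈L , 0<s , p<qs) =
    ℚ.<-asym (ℚ.<-trans qr<p p<qs) (*-monoʳ-< 0<q (L<U x s∈L r∈U))
    where
    0<q : 0ℚ ℚ.< q
    0<q = *-cancelʳ-< 0<s (ℚ.≤-<-trans (ℚ.≤-reflexive (ℚ.*-zeroˡ s)) (ℚ.<-trans 0<p p<qs))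

  quot-located : ∀ {q q′} → q ℚ.< q′ → quotL q ⊎ quotU q′
  quot-located {q} {q′} q<q′ with 0ℚ ℚ.<? q
  ... | no  0≮q = inj₁ (quotL-≤0 (ℚ.≮⇒≥ 0≮q))
  ... | yes 0<q =
    let 0<q′            = ℚ.<-trans 0<q q<q′
        (t , tq′≡p)     = quotient 0<q′ p
        (u , uq≡p)      = quotient 0<q p
        0<t             = quotient-pos 0<q′ {t} tq′≡p 0<p
        0<u             = quotient-pos 0<q {u} uq≡p 0<p
        t<u             = *-cancelʳ-< 0<q′ (subst (ℚ._< u ℚ.* q′) (trans uq≡p (sym tq′≡p)) (*-monoʳ-< 0<u {q} {q′} q<q′))
        (b , t<b , b<u) = ℚ.<-dense t<u
        (a , t<a , a<b) = ℚ.<-dense t<b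
    in Sum.map
      (λ b∈U → b , b∈U , subst₂ ℚ._<_ refl (trans (ℚ.*-comm q u) uq≡p) (*-monoʳ-< 0<q b<u))
      (λ a∈L → a , a∈L , ℚ.<-trans 0<t t<a , subst₂ ℚ._<_ (trans (ℚ.*-comm q′ t) tq′≡p) refl (*-monoʳ-< 0<q′ t<a))
      (swap (located x a<b))

  quot : ℝ
  quot = record
    { L           = quotL
    ; U           = quotU
    ; L-inhabited = 0ℚ , quotL-≤0 ℚ.≤-refl
    ; U-inhabited = quotU-inhabited
    ; L-lower     = λ {q} {q′} q<q′ (r , r∈U , q′r<p) → r , r∈U , ℚ.<-trans (*-monoˡ-< (U-pos r∈U) {q} {q′} q<q′) q′r<p
    ; U-upper     = λ {q} {q′} q<q′ (r , r∈L , 0<r , p<qr) → r , r∈L , 0<r , ℚ.<-trans p<qr (*-monoˡ-< 0<r {q} {q′} q<q′)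
    ; L-open      = quotL-open
    ; U-open      = quotU-open
    ; disjoint    = λ {q} → quot-disjoint {q}
    ; located     = quot-located
    }

  quot-irrational : Irrational x → Irrational quot
  quot-irrational x-irr q with 0ℚ ℚ.<? q
  ... | no  0≮q = inj₂ (L⇒< quot (quotL-≤0 (ℚ.≮⇒≥ 0≮q)))
  ... | yes 0<q = let (t , tq≡p) = quotient 0<q p in at t tq≡p (x-irr t)
    where
    at : ∀ t → t ℚ.* q ≡ p → x # fromℚ t → quot # fromℚ q
    at t tq≡p (inj₁ (r , r∈U , r<t)) = inj₂ (L⇒< quot
      (r , r∈U , subst (q ℚ.* r ℚ.<_) (trans (ℚ.*-comm q t) tq≡p) (*-monoʳ-< 0<q r<t)))
    at t tq≡p (inj₂ (r , t<r , r∈L)) = inj₁ (U⇒< quot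
      (r , r∈L , ℚ.<-trans (quotient-pos 0<q {t} tq≡p 0<p) t<r ,
       subst (ℚ._< q ℚ.* r) (trans (ℚ.*-comm q t) tq≡p) (*-monoʳ-< 0<q t<r)))

open Division using (quot; quotL-≤0; quot-irrational)

module Subtraction (x : ℝ) (p : ℚ) where

  private
    cancel : ∀ q → (q ℚ.- p) ℚ.+ p ≡ q
    cancel q = trans (ℚ.+-assoc q (ℚ.- p) p)
      (trans (cong (q ℚ.+_) (ℚ.+-inverseˡ p)) (ℚ.+-identityʳ q))

    cancel-< : ∀ {q r} → q ℚ.+ p ℚ.< r → q ℚ.< r ℚ.- p
    cancel-< {q} {r} h = subst (ℚ._< r ℚ.- p)
      (trans (ℚ.+-assoc q p (ℚ.- p)) (trans (cong (q ℚ.+_) (ℚ.+-inverseʳ p)) (ℚ.+-identityʳ q)))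
      (ℚ.+-monoˡ-< (ℚ.- p) h)

    cancel-> : ∀ {q r} → r ℚ.< q ℚ.+ p → r ℚ.- p ℚ.< q
    cancel-> {q} {r} h = subst (r ℚ.- p ℚ.<_)
      (trans (ℚ.+-assoc q p (ℚ.- p)) (trans (cong (q ℚ.+_) (ℚ.+-inverseʳ p)) (ℚ.+-identityʳ q)))
      (ℚ.+-monoˡ-< (ℚ.- p) h)

  minus : ℝ
  minus = record
    { L           = λ q → L x (q ℚ.+ p)
    ; U           = λ q → U x (q ℚ.+ p)
    ; L-inhabited = let (q , q∈L) = L-inhabited x in q ℚ.- p , subst (L x) (sym (cancel q)) q∈L
    ; U-inhabited = let (q , q∈U) = U-inhabited x in q ℚ.- p , subst (U x) (sym (cancel q)) q∈U
    ; L-lower     = λ q<r → L-lower x (ℚ.+-monoˡ-< p q<r)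
    ; U-upper     = λ q<r → U-upper x (ℚ.+-monoˡ-< p q<r)
    ; L-open      = λ q∈L → let (r , h , r∈L) = L-open x q∈L in
                      r ℚ.- p , cancel-< h , subst (L x) (sym (cancel r)) r∈L
    ; U-open      = λ q∈U → let (r , h , r∈U) = U-open x q∈U in
                      r ℚ.- p , cancel-> h , subst (U x) (sym (cancel r)) r∈U
    ; disjoint    = disjoint x
    ; located     = λ q<r → located x (ℚ.+-monoˡ-< p q<r)
    }

  minus-irrational : Irrational x → Irrational minus
  minus-irrational x-irr q = Sum.map (U⇒< minus ∘ <⇒U x) (L⇒< minus ∘ <⇒L x) (x-irr (q ℚ.+ p))

open Subtraction using (minus-irrational) renaming (minus to infixl 6 _-_)

IsFloor : ℝ → ℕ → Set
IsFloor y n = fromℕ n ≤ y × y < fromℕ (suc n)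

floor : (y : ℝ) → Irrational y → 0ℝ ≤ y → ∃ (IsFloor y)
floor y y-irr 0≤y = let (q , q∈U) = U-inhabited y in below ℤ.∣ ℚ.↥ q ∣ (bound q q∈U)
  where
  q≤∣↥q∣ : ∀ q → q ℚ.≤ fromℤ (+ ℤ.∣ ℚ.↥ q ∣)
  q≤∣↥q∣ (ℚ.mkℚ (+ n) d _) = ℚ.*≤* (ℤ.*-monoˡ-≤-nonNeg (+ n) (ℤ.+≤+ (ℕ.s≤s ℕ.z≤n)))
  q≤∣↥q∣ q@(ℚ.mkℚ ℤ.-[1+ n ] d _) = ℚ.≤-trans (ℚ.nonPositive⁻¹ q) (ℚ.nonNegative⁻¹ (fromℤ (+ suc n)))

  bound : ∀ q → U y q → y < fromℕ ℤ.∣ ℚ.↥ q ∣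
  bound q q∈U = let (r , r∈U , r<q) = U⇒< y q∈U in r , r∈U , ℚ.<-≤-trans r<q (q≤∣↥q∣ q)

  below : ∀ m → y < fromℕ m → ∃ (IsFloor y)
  below zero    y<0  = ⊥-elim (0≤y y<0)
  below (suc m) y<1+m with y-irr (fromℤ (+ m))
  ... | inj₁ y<m = below m y<m
  ... | inj₂ m<y = m , (λ y<m → disjoint y (<⇒L y m<y) (<⇒U y y<m)) , y<1+m

record UnitIrrational : Set₁ where
  field
    value      : ℝ
    0≤value    : 0ℝ ≤ value
    value≤1    : value ≤ 1ℝ
    irrational : Irrational value

open UnitIrrational

value>0 : (x : UnitIrrational) → 0ℝ < value x
value>0 x with irrational x 0ℚ
... | inj₁ x<0 = ⊥-elim (0≤value x x<0)
... | inj₂ 0<x = 0<x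

module _ (N : ℕ) .{{_ : ℕ.NonZero N}} where

  private
    0<N : 0ℚ ℚ.< fromℤ (+ N)
    0<N = ℚ.*<* (subst₂ ℤ._<_ refl (sym (ℤ.*-identityʳ (+ N))) (ℤ.+<+ (ℕ.>-nonZero⁻¹ N)))

  N/ : UnitIrrational → ℝ
  N/ x = quot 0<N (value x) (value>0 x)

  N/-irrational : ∀ x → Irrational (N/ x)
  N/-irrational x = quot-irrational 0<N (value x) (value>0 x) (irrational x)

  N/-nonNeg : ∀ x → 0ℝ ≤ N/ x
  N/-nonNeg x y<0 = disjoint (N/ x) {0ℚ} (quotL-≤0 0<N (value x) (value>0 x) ℚ.≤-refl) (<⇒U (N/ x) y<0)

  ⌊N/_⌋ : UnitIrrational → ℕ
  ⌊N/ x ⌋ = proj₁ (floor (N/ x) (N/-irrational x) (N/-nonNeg x))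

  ⌊N/⌋-isFloor : ∀ x → IsFloor (N/ x) ⌊N/ x ⌋
  ⌊N/⌋-isFloor x = proj₂ (floor (N/ x) (N/-irrational x) (N/-nonNeg x))

  -- T_N maps irrational points of [0,1] to irrational points of [0,1]; only
  -- these points have digit expansions, so its values at rationals play no role.

  T : UnitIrrational → UnitIrrational
  T x = record
    { value      = Tx
    ; 0≤value    = λ Tx<0 → n≤y (U⇒< y (subst (U y) (ℚ.+-identityˡ (fromℤ (+ n))) (<⇒U Tx Tx<0)))
    ; value≤1    = λ 1<Tx → disjoint y {fromℤ (+ suc n)} (subst (L y) (1+fromℤ n) (<⇒L Tx 1<Tx)) (<⇒U y y<1+n)
    ; irrational = minus-irrational y (fromℤ (+ n)) (N/-irrational x)
    }
    where
    y : ℝ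
    y = N/ x

    n : ℕ
    n = ⌊N/ x ⌋

    n≤y : fromℕ n ≤ y
    n≤y = proj₁ (⌊N/⌋-isFloor x)

    y<1+n : y < fromℕ (suc n)
    y<1+n = proj₂ (⌊N/⌋-isFloor x)

    Tx : ℝ
    Tx = y - fromℤ (+ n)

    1+fromℤ : ∀ m → fromℤ (+ 1) ℚ.+ fromℤ (+ m) ≡ fromℤ (+ suc m)
    1+fromℤ m = trans (cong (ℚ._/ 1) (cong (ℤ._+_ (+ 1)) (ℤ.*-identityʳ (+ m)))) (ℚ.↥p/↧p≡p (fromℤ (+ suc m)))

  T^ : ℕ → UnitIrrational → UnitIrrational
  T^ zero    x = x
  T^ (suc n) x = T (T^ n x)

  -- Indexed from 0: digit x n is d_{n+1}.

  digit : UnitIrrational → ℕ → ℕ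
  digit x n = ⌊N/ T^ n x ⌋

Letter : Set
Letter = Fin 2

Word InfiniteWord Substitution : Set
Word         = List Letter
InfiniteWord = ℕ → Letter
Substitution = Letter → List⁺ Letter

-- prepend τ w ν is the infinite word w τ(ν₀) τ(ν₁) τ(ν₂) ….

prepend : Substitution → List⁺ Letter → InfiniteWord → InfiniteWord
prepend τ (a ∷ _)     ν zero    = a
prepend τ (a ∷ [])    ν (suc i) = prepend τ (τ (ν 0)) (ν ∘ suc) i
prepend τ (a ∷ b ∷ w) ν (suc i) = prepend τ (b ∷ w) ν i

substitute : Substitution → InfiniteWord → InfiniteWord
substitute τ ν = prepend τ (τ (ν 0)) (ν ∘ suc)

-- The sequence of substitutions is indexed from 0, as are the words w n.

_GeneratedBy_ : InfiniteWord → (ℕ → Substitution) → Set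
ω GeneratedBy τ = ∃ λ (w : ℕ → InfiniteWord) →
  w 0 ≗ ω × (∀ n → w n ≗ substitute (τ n) (w (suc n)))

module _ (N : ℕ) .{{_ : ℕ.NonZero N}} where

  _^N : Letter → List⁺ Letter
  a ^N = List⁺.replicate N (ℕ.≢-nonZero⁻¹ N) a

  σ σ̂ : ℕ → Substitution
  σ d 0F = List.replicate d 0F ++⁺ (1F ^N)
  σ d 1F = [ 0F ]
  σ̂ d 0F = List.replicate d 0F ++⁺ [ 1F ]
  σ̂ d 1F = 0F ^N

  IsNCFSequence IsDualNCFSequence : UnitIrrational → InfiniteWord → Set
  IsNCFSequence     x ω = ω GeneratedBy (λ n → σ (digit N x n))
  IsDualNCFSequence x ω = ω GeneratedBy (λ n → σ̂ (digit N x n))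

∣_∣[_] : Word → Letter → ℕ
∣ u ∣[ a ] = length (filter (_≟ a) u)

_FactorOf_ : Word → InfiniteWord → Set
u FactorOf ν = ∃ λ i → u ≡ applyUpTo (λ j → ν (i ℕ.+ j)) (length u)

Balanced : ℕ → InfiniteWord → Set
Balanced C ν = ∀ u v → u FactorOf ν → v FactorOf ν → length u ≡ length v →
  ∀ a → ℤ.- + C ℤ.≤ + ∣ u ∣[ a ] ℤ.- + ∣ v ∣[ a ] × + ∣ u ∣[ a ] ℤ.- + ∣ v ∣[ a ] ℤ.≤ + C

{-# OPTIONS --safe #-}

-- Every level of the desubstitution begins with 0, since all images of letters do.
--
-- (1) The second level contains 00 and 10, which are mapped to 0^d 1 0^d 1 and 0^N 0^d 1
-- (d = d₁).  As N ≥ 2, both 1 0^d 1 and 0^(d+2) are factors, and they differ by 2 in the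
-- number of zeros.
--
-- (2) The third level contains 00 and 110, so the second level contains 1^N 0^e 1^N 0 and
-- 0^(e+2) (e = d₂).  Writing B = 0^d 1^N for σ₁(0), the first level contains
-- 0^N B^e 0^N 0^d and, inside B^(e+2), the word 1^N B B^e of the same length.  The number
-- of zeros drops by 2N from the former to the latter.

module Submission where

open import Data.Fin.Patterns using (0F; 1F)
open import Data.Fin.Properties using (_≟_)
import Data.Integer.Base as ℤ
import Data.Integer.Properties as ℤ
open import Data.List.Base as List
  using (List; []; _∷_; [_]; _++_; length; filter; applyUpTo; concatMap; replicate)
open import Data.List.NonEmpty.Base as List⁺ using (List⁺; _∷_; _++⁺_)
open import Data.List.Properties
  using (length-++; length-replicate; filter-++; concatMap-++; ++-assoc; ++-identityʳ; ++-monoid)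
open import Data.Nat.Base using (ℕ; zero; suc; NonZero; _≤_; _*_; _∸_; _+_; s≤s; z≤n)
import Data.Nat.Properties as ℕ
open import Data.Nat.Tactic.RingSolver using (solve-∀)
open import Data.Product.Base using (_×_; _,_; proj₁; proj₂)
open import Data.Rational.Base as ℚ using (1ℚ)
open import Data.Rational.Literals using (fromℤ)
import Data.Rational.Properties as ℚ
open import Function.Base using (_∘_)
open import Relation.Binary.PropositionalEquality
  using (_≡_; _≗_; refl; sym; trans; cong; cong₂; subst; module ≡-Reasoning)
open import Relation.Nullary using (¬_)
open import Tactic.MonoidSolver using (solve)
open import Defs using
  ( UnitIrrational; InfiniteWord; IsNCFSequence; IsDualNCFSequence; Balanced; Word; Letter; Substitution
  ; substitute; prepend; σ; σ̂; digit; T^; ⌊N/⌋-isFloor; IsFloor; module ℝ; N/; <⇒U; L⇒<; ∣_∣[_]; _FactorOf_; _GeneratedBy_)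

-- Digits are at least N.

floor-N/-≥N : ∀ {N} .{{_ : NonZero N}} x {n} → IsFloor (N/ N x) n → N ≤ n
floor-N/-≥N {N} x {n} (_ , y<1+n) with <⇒U (N/ N x) {fromℤ (ℤ.+ suc n)} y<1+n
-- The cut of N/x below n+1 supplies a rational `r` < x with N < (n+1)r. As x ≤ 1 forces `r` ≤ 1, n
-- < N would give (n+1)r ≤ n+1 ≤ N.
... | r , r∈L , _ , N<[1+n]r = ℕ.≮⇒≥ λ n<N →
  ℚ.<-irrefl refl (ℚ.<-≤-trans N<[1+n]r (ℚ.≤-trans [1+n]r≤1+n (fromℤ-mono n<N)))
  where
  open UnitIrrational x

  r≤1 : r ℚ.≤ 1ℚ
  r≤1 = ℚ.≮⇒≥ λ 1<r → value≤1 (L⇒< value {1ℚ} (ℝ.L-lower value {1ℚ} {r} 1<r r∈L))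

  [1+n]r≤1+n : fromℤ (ℤ.+ suc n) ℚ.* r ℚ.≤ fromℤ (ℤ.+ suc n)
  [1+n]r≤1+n = subst (fromℤ (ℤ.+ suc n) ℚ.* r ℚ.≤_) (ℚ.*-identityʳ (fromℤ (ℤ.+ suc n)))
    (ℚ.*-monoˡ-≤-nonNeg (fromℤ (ℤ.+ suc n)) r≤1)

  fromℤ-mono : ∀ {k l} → k ≤ l → fromℤ (ℤ.+ k) ℚ.≤ fromℤ (ℤ.+ l)
  fromℤ-mono k≤l = ℚ.*≤* (ℤ.*-monoʳ-≤-nonNeg (ℤ.+ 1) (ℤ.+≤+ k≤l))

N≤digit : ∀ N .{{_ : NonZero N}} x n → N ≤ digit N x n
N≤digit N x n = floor-N/-≥N {N} (T^ N n x) {digit N x n} (⌊N/⌋-isFloor N (T^ N n x))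

-- Prefixes and occurrences in infinite words.

infixr 5 _∷_

-- Inductive, so that proofs follow the recursion of `prepend`; `prefix⇒≡applyUpTo` returns to the
-- form used by `_FactorOf_`.
data _PrefixOf_ : Word → InfiniteWord → Set where
  []  : ∀ {ν} → [] PrefixOf ν
  _∷_ : ∀ {a u ν} → a ≡ ν 0 → u PrefixOf (ν ∘ suc) → (a ∷ u) PrefixOf ν

prefix-cong : ∀ {μ ν u} → μ ≗ ν → u PrefixOf μ → u PrefixOf ν
prefix-cong μ≗ν []       = []
prefix-cong μ≗ν (eq ∷ p) = trans eq (μ≗ν 0) ∷ prefix-cong (μ≗ν ∘ suc) p

prefix-++⁻ˡ : ∀ {ν} u {v} → (u ++ v) PrefixOf ν → u PrefixOf ν
prefix-++⁻ˡ []      _        = []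
prefix-++⁻ˡ (a ∷ u) (eq ∷ p) = eq ∷ prefix-++⁻ˡ u p

prefix-++⁻ʳ : ∀ {ν} u {v} → (u ++ v) PrefixOf ν → v PrefixOf (λ j → ν (length u + j))
prefix-++⁻ʳ []      p        = p
prefix-++⁻ʳ (a ∷ u) (eq ∷ p) = prefix-++⁻ʳ u p

prefix⇒≡applyUpTo : ∀ {ν u} → u PrefixOf ν → u ≡ applyUpTo ν (length u)
prefix⇒≡applyUpTo []       = refl
prefix⇒≡applyUpTo (eq ∷ p) = cong₂ _∷_ eq (prefix⇒≡applyUpTo p)

-- The position is kept as the whole word before `u`, not as an index: a substitution maps this word
-- to the word before the image of `u`.
record _OccursIn_ (u : Word) (ν : InfiniteWord) : Set where
  constructor occurs
  field
    before : Word
    prefix : (before ++ u) PrefixOf ν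

occurs⇒factor : ∀ {ν u} → u OccursIn ν → u FactorOf ν
occurs⇒factor (occurs p q) = length p , prefix⇒≡applyUpTo (prefix-++⁻ʳ p q)

occurs-cong : ∀ {μ ν u} → μ ≗ ν → u OccursIn μ → u OccursIn ν
occurs-cong μ≗ν (occurs p q) = occurs p (prefix-cong μ≗ν q)

occurs-infix : ∀ {ν w} u v s → w ≡ u ++ v ++ s → w OccursIn ν → v OccursIn ν
occurs-infix {ν} u v s refl (occurs p q) = occurs (p ++ u) (prefix-++⁻ˡ ((p ++ u) ++ v)
  (subst (_PrefixOf ν) (trans (sym (++-assoc p u (v ++ s))) (sym (++-assoc (p ++ u) v s))) q))

-- Images of occurrences under a substitution.

-- The letter a accounts for the beginning of the image of the letter following the prefix.
module _ {τ : Substitution} {f : Letter → Word} (τ≗f : List⁺.toList ∘ τ ≗ f)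
         {a : Letter} (head-τ : ∀ b → List⁺.head (τ b) ≡ a) where

  prefix-prepend : ∀ {ν u} b w → u PrefixOf substitute τ ν → (b ∷ w ++ u) PrefixOf prepend τ (b ∷ w) ν
  prefix-prepend b []      p = refl ∷ p
  prefix-prepend b (c ∷ w) p = refl ∷ prefix-prepend c w p

  prefix-substitute : ∀ {ν u} → u PrefixOf ν → (concatMap f u ++ [ a ]) PrefixOf substitute τ ν
  prefix-substitute {ν} [] with τ (ν 0) | head-τ (ν 0)
  ... | b ∷ []    | refl = refl ∷ []
  ... | b ∷ _ ∷ _ | refl = refl ∷ []
  prefix-substitute {ν} {b ∷ u} (refl ∷ p) = subst (_PrefixOf substitute τ ν) eq
    (prefix-prepend (List⁺.head (τ b)) (List⁺.tail (τ b)) (prefix-substitute p))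
    where
    eq : List⁺.toList (τ b) ++ concatMap f u ++ [ a ] ≡ (f b ++ concatMap f u) ++ [ a ]
    eq = trans (cong (_++ concatMap f u ++ [ a ]) (τ≗f b)) (sym (++-assoc (f b) _ _))

  occurs-substitute : ∀ {ν u} → u OccursIn ν → (concatMap f u ++ [ a ]) OccursIn substitute τ ν
  occurs-substitute {u = u} (occurs p q) = occurs (concatMap f p) (subst (_PrefixOf _)
    (trans (cong (_++ [ a ]) (concatMap-++ f p u)) (++-assoc (concatMap f p) _ _))
    (prefix-substitute q))

unbalanced : ∀ {C ν} u v → u FactorOf ν → v FactorOf ν → length u ≡ length v →
  ∀ a → ∣ u ∣[ a ] ≡ suc C + ∣ v ∣[ a ] → ¬ Balanced C ν
unbalanced {C} u v hu hv eq a excess balanced =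
  let _ , bound = balanced u v hu hv eq a
      difference : ℤ.+ ∣ u ∣[ a ] ℤ.- ℤ.+ ∣ v ∣[ a ] ≡ ℤ.+ suc C
      difference = trans (cong (λ n → ℤ.+ n ℤ.- ℤ.+ ∣ v ∣[ a ]) excess)
        (trans (ℤ.m-n≡m⊖n (suc C + ∣ v ∣[ a ]) ∣ v ∣[ a ])
          (trans (ℤ.⊖-≥ (ℕ.m≤n+m ∣ v ∣[ a ] (suc C))) (cong ℤ.+_ (ℕ.m+n∸n≡m (suc C) ∣ v ∣[ a ]))))
  in ℕ.<-irrefl refl (ℤ.drop‿+≤+ (subst (ℤ._≤ ℤ.+ C) difference bound))

∣++∣ : ∀ u v a → ∣ u ++ v ∣[ a ] ≡ ∣ u ∣[ a ] + ∣ v ∣[ a ]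
∣++∣ u v a = trans (cong length (filter-++ (_≟ a) u v)) (length-++ (filter (_≟ a) u))

∣0^∣₀ : ∀ n → ∣ replicate n 0F ∣[ 0F ] ≡ n
∣0^∣₀ zero    = refl
∣0^∣₀ (suc n) = cong suc (∣0^∣₀ n)

∣1^∣₀ : ∀ n → ∣ replicate n 1F ∣[ 0F ] ≡ 0
∣1^∣₀ zero    = refl
∣1^∣₀ (suc n) = ∣1^∣₀ n

toList-++⁺ : ∀ {A : Set} (xs : List A) (ys : List⁺ A) → List⁺.toList (xs ++⁺ ys) ≡ xs ++ List⁺.toList ys
toList-++⁺ []       ys = refl
toList-++⁺ (x ∷ xs) ys = cong (x ∷_) (toList-++⁺ xs ys)

-- Words occurring at the levels of the desubstitution.

module Levels {ω : InfiniteWord} {τ : ℕ → Substitution} {f : ℕ → Letter → Word}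
              (τ≗f : ∀ n → List⁺.toList ∘ τ n ≗ f n)
              (head-τ : ∀ n b → List⁺.head (τ n b) ≡ 0F)
              (generated : ω GeneratedBy τ) where

  private
    w : ℕ → InfiniteWord
    w = proj₁ generated

    w₀≗ω : w 0 ≗ ω
    w₀≗ω = proj₁ (proj₂ generated)

    step : ∀ n → w n ≗ substitute (τ n) (w (suc n))
    step = proj₂ (proj₂ generated)

  -- Already the empty prefix of the next level gives a letter here: the common first letter of all
  -- images.
  zero-occurs : ∀ n → [ 0F ] OccursIn w n
  zero-occurs n = occurs [] (prefix-cong (sym ∘ step n) (prefix-substitute (τ≗f n) (head-τ n) ([] {w (suc n)})))

  descend : ∀ n {u} → u OccursIn w (suc n) → (concatMap (f n) u ++ [ 0F ]) OccursIn w n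
  descend n h = occurs-cong (sym ∘ step n) (occurs-substitute (τ≗f n) (head-τ n) h)

  f0-occurs : ∀ n → (f n 0F ++ [ 0F ]) OccursIn w n
  f0-occurs n = subst (λ u → (u ++ [ 0F ]) OccursIn w n) (++-identityʳ (f n 0F))
    (descend n (zero-occurs (suc n)))

  occurs⇒factor-ω : ∀ {u} → u OccursIn w 0 → u FactorOf ω
  occurs⇒factor-ω = occurs⇒factor ∘ occurs-cong w₀≗ω

-- The two substitutions as maps to words.

concatMap-replicate-[_] : ∀ {A B : Set} (b : B) {f : A → List B} {a} → f a ≡ [ b ] →
  ∀ n → concatMap f (replicate n a) ≡ replicate n b
concatMap-replicate-[ b ] eq zero    = refl
concatMap-replicate-[ b ] eq (suc n) = cong₂ _++_ eq (concatMap-replicate-[ b ] eq n)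

-- A power of length 2 + m unfolds with two letters in front; this moves them to its end, next to
-- what follows.
replicate-∷-comm : ∀ {A : Set} n {a : A} u → replicate n a ++ a ∷ u ≡ a ∷ replicate n a ++ u
replicate-∷-comm zero    u = refl
replicate-∷-comm (suc n) u = cong (_ ∷_) (replicate-∷-comm n u)

module Blocks (m : ℕ) where

  N : ℕ
  N = 2 + m

  B B̂ : ℕ → Letter → Word
  B d 0F = replicate d 0F ++ replicate N 1F
  B d 1F = [ 0F ]
  B̂ d 0F = replicate d 0F ++ [ 1F ]
  B̂ d 1F = replicate N 0F

  toList-σ : ∀ d → List⁺.toList ∘ σ N d ≗ B d
  toList-σ d 0F = toList-++⁺ (replicate d 0F) _
  toList-σ d 1F = refl

  toList-σ̂ : ∀ d → List⁺.toList ∘ σ̂ N d ≗ B̂ d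
  toList-σ̂ d 0F = toList-++⁺ (replicate d 0F) _
  toList-σ̂ d 1F = refl

  -- The image of 0 begins with 0 because d ≥ N ≥ 1; for d = 0 it would begin with 1.
  head-σ : ∀ {d} → N ≤ d → ∀ b → List⁺.head (σ N d b) ≡ 0F
  head-σ (s≤s _) 0F = refl
  head-σ (s≤s _) 1F = refl

  head-σ̂ : ∀ {d} → N ≤ d → ∀ b → List⁺.head (σ̂ N d b) ≡ 0F
  head-σ̂ (s≤s _) 0F = refl
  head-σ̂ (s≤s _) 1F = refl

  -- Here d ≥ N ≥ 2, so the power itself begins with 00.
  00-infix : ∀ {d} → N ≤ d → ∀ {ν} u → (replicate d 0F ++ u) OccursIn ν → (0F ∷ 0F ∷ []) OccursIn ν
  00-infix {suc (suc d)} _ u = occurs-infix [] (0F ∷ 0F ∷ []) (replicate d 0F ++ u) refl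
  00-infix {suc zero} (s≤s ())

  module _ (digits : ℕ → ℕ) (N≤digits : ∀ n → N ≤ digits n) where

    private
      d e : ℕ
      d = digits 0
      e = digits 1

      0^d 0^e 0^N 1^N : Word
      0^d = replicate d 0F
      0^e = replicate e 0F
      0^N = replicate N 0F
      1^N = replicate N 1F

    -- The dual sequence.

    dual-unbalanced : ∀ {ω} → ω GeneratedBy (σ̂ N ∘ digits) → ¬ Balanced 1 ω
    dual-unbalanced {ω} gen = unbalanced {1} {ω} (0F ∷ 0F ∷ 0^d) (1F ∷ 0^d ++ [ 1F ]) zeros ones lengths 0F counts
      where
      open Levels (toList-σ̂ ∘ digits) (head-σ̂ ∘ N≤digits) gen

      -- Levels are counted from 1, so this is a word of level `w 1`: the image of 0, followed by
      -- the first letter of the next image.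
      level₂ : (0^e ++ 1F ∷ 0F ∷ []) OccursIn _
      level₂ = subst (_OccursIn _) (++-assoc 0^e [ 1F ] [ 0F ]) (f0-occurs 1)

      zeros : (0F ∷ 0F ∷ 0^d) FactorOf ω
      -- In the image 0^N 0^d 1 of 10 the first m = N - 2 zeros are skipped, leaving 0^(d+2) before
      -- the 1.
      zeros = occurs⇒factor-ω (occurs-infix (replicate m 0F) (0F ∷ 0F ∷ 0^d) (1F ∷ 0F ∷ []) eq
        (descend 0 (occurs-infix 0^e (1F ∷ 0F ∷ []) [] refl level₂)))
        where
        eq : (0^N ++ (0^d ++ [ 1F ]) ++ []) ++ [ 0F ] ≡ replicate m 0F ++ 0F ∷ 0F ∷ 0^d ++ 1F ∷ 0F ∷ []
        eq = trans (solve++ 0^N 0^d [ 1F ] [ 0F ])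
          (sym (trans (replicate-∷-comm m _) (cong (0F ∷_) (replicate-∷-comm m _))))
          where
          solve++ : ∀ (a b c e : Word) → (a ++ (b ++ c) ++ []) ++ e ≡ a ++ b ++ c ++ e
          solve++ a b c e = solve (++-monoid Letter)

      ones : (1F ∷ 0^d ++ [ 1F ]) FactorOf ω
      ones = occurs⇒factor-ω (occurs-infix 0^d (1F ∷ 0^d ++ [ 1F ]) [ 0F ] (eq 0^d [ 1F ] [ 0F ])
        (descend 0 (00-infix (N≤digits 1) (1F ∷ 0F ∷ []) level₂)))
        where
        eq : ∀ (a b c : Word) → ((a ++ b) ++ (a ++ b) ++ []) ++ c ≡ a ++ (b ++ a ++ b) ++ c
        eq a b c = solve (++-monoid Letter)

      lengths : length (0F ∷ 0F ∷ 0^d) ≡ length (1F ∷ 0^d ++ [ 1F ])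
      lengths = cong suc (sym (trans (length-++ 0^d) (ℕ.+-comm _ 1)))

      counts : ∣ 0F ∷ 0F ∷ 0^d ∣[ 0F ] ≡ 2 + ∣ 1F ∷ 0^d ++ [ 1F ] ∣[ 0F ]
      counts = cong (suc ∘ suc) (sym (trans (∣++∣ 0^d [ 1F ] 0F) (ℕ.+-identityʳ _)))

    -- The NCF sequence.

    unbalanced-2N∸1 : ∀ {ω} → ω GeneratedBy (σ N ∘ digits) → ¬ Balanced (2 * N ∸ 1) ω
    unbalanced-2N∸1 {ω} gen = unbalanced {2 * N ∸ 1} {ω} u v u-factor v-factor lengths 0F counts
      where
      open Levels (toList-σ ∘ digits) (head-σ ∘ N≤digits) gen

      X u v : Word
      -- `X` is B^e. Up to order, `u` and `v` share the blocks `X` and 0^d; `u` has two further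
      -- blocks 0^N where `v` has two blocks 1^N. Hence equal lengths and an excess of 2N zeros.
      X = concatMap (B d) 0^e
      u = 0^N ++ X ++ 0^N ++ 0^d
      v = 1^N ++ (0^d ++ 1^N) ++ X

      level₃ : (replicate (digits 2) 0F ++ 1^N ++ [ 0F ]) OccursIn _
      level₃ = subst (_OccursIn _) (++-assoc (replicate (digits 2) 0F) 1^N [ 0F ]) (f0-occurs 2)

      level₂-ones : (1^N ++ 0^e ++ 1^N ++ [ 0F ]) OccursIn _
      -- The image of 00 is 0^e 1^N 0^e 1^N, followed by 0; its first 0^e is dropped.
      level₂-ones = occurs-infix 0^e (1^N ++ 0^e ++ 1^N ++ [ 0F ]) [] (eq 0^e 1^N [ 0F ])
        (descend 1 (00-infix (N≤digits 2) (1^N ++ [ 0F ]) level₃))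
        where
        eq : ∀ (a b c : Word) → ((a ++ b) ++ (a ++ b) ++ []) ++ c ≡ a ++ (b ++ a ++ b ++ c) ++ []
        eq a b c = solve (++-monoid Letter)

      level₂-zeros : (0F ∷ 0F ∷ 0^e) OccursIn _
      -- Each 1 of 110 becomes a single 0, and these two precede the 0^e that starts the image of 0.
      -- The two 1s are there because N ≥ 2.
      level₂-zeros = occurs-infix [] (0F ∷ 0F ∷ 0^e) (1^N ++ [ 0F ]) (cong (λ t → 0F ∷ 0F ∷ t) (eq 0^e 1^N [ 0F ]))
        (descend 1
          (occurs-infix (replicate (digits 2) 0F ++ replicate m 1F) (1F ∷ 1F ∷ 0F ∷ []) [] 110-suffix level₃))
        where
        eq : ∀ (a b c : Word) → ((a ++ b) ++ []) ++ c ≡ a ++ b ++ c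
        eq a b c = solve (++-monoid Letter)

        110-suffix : replicate (digits 2) 0F ++ 1^N ++ [ 0F ] ≡
                     (replicate (digits 2) 0F ++ replicate m 1F) ++ 1F ∷ 1F ∷ 0F ∷ []
        110-suffix = trans
          (cong (replicate (digits 2) 0F ++_)
            (sym (trans (replicate-∷-comm m _) (cong (1F ∷_) (replicate-∷-comm m [ 0F ])))))
          (sym (++-assoc (replicate (digits 2) 0F) _ _))

      u-factor : u FactorOf ω
      -- The final 0 of the second-level word contributes a block 0^d 1^N, of which `u` keeps only
      -- 0^d.
      u-factor = occurs⇒factor-ω (occurs-infix [] u (1^N ++ [ 0F ]) eq (descend 0 level₂-ones))
        where
        image : concatMap (B d) (1^N ++ 0^e ++ 1^N ++ [ 0F ]) ≡ 0^N ++ X ++ 0^N ++ (0^d ++ 1^N) ++ []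
        image = begin
          concatMap (B d) (1^N ++ 0^e ++ 1^N ++ [ 0F ])
            ≡⟨ concatMap-++ (B d) 1^N _ ⟩
          concatMap (B d) 1^N ++ concatMap (B d) (0^e ++ 1^N ++ [ 0F ])
            ≡⟨ cong₂ _++_ 1^N↦0^N (concatMap-++ (B d) 0^e _) ⟩
          0^N ++ X ++ concatMap (B d) (1^N ++ [ 0F ])
            ≡⟨ cong (λ t → 0^N ++ X ++ t) (concatMap-++ (B d) 1^N [ 0F ]) ⟩
          0^N ++ X ++ concatMap (B d) 1^N ++ B d 0F ++ []
            ≡⟨ cong (λ t → 0^N ++ X ++ t ++ B d 0F ++ []) 1^N↦0^N ⟩
          0^N ++ X ++ 0^N ++ B d 0F ++ [] ∎
          where
          open ≡-Reasoning

          1^N↦0^N : concatMap (B d) 1^N ≡ 0^N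
          1^N↦0^N = concatMap-replicate-[ 0F ] {B d} {1F} refl N

        reassoc : ∀ (a b c e f : Word) →
          (a ++ b ++ a ++ (c ++ e) ++ []) ++ f ≡ (a ++ b ++ a ++ c) ++ e ++ f
        reassoc a b c e f = solve (++-monoid Letter)

        eq : concatMap (B d) (1^N ++ 0^e ++ 1^N ++ [ 0F ]) ++ [ 0F ] ≡ u ++ 1^N ++ [ 0F ]
        eq = trans (cong (_++ [ 0F ]) image) (reassoc 0^N X 0^d 1^N [ 0F ])

      v-factor : v FactorOf ω
      -- The image of 0 0 0^e is B B `X`; `v` starts after the 0^d of the first B.
      v-factor = occurs⇒factor-ω (occurs-infix 0^d v [ 0F ] (eq 0^d 1^N X [ 0F ]) (descend 0 level₂-zeros))
        where
        eq : ∀ (a b c e : Word) → ((a ++ b) ++ (a ++ b) ++ c) ++ e ≡ a ++ (b ++ (a ++ b) ++ c) ++ e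
        eq a b c e = solve (++-monoid Letter)

      lengths : length u ≡ length v
      lengths = begin
        length u
          ≡⟨ length-++⁴ 0^N X 0^N 0^d ⟩
        length 0^N + (length X + (length 0^N + length 0^d))
          ≡⟨ cong (λ n → n + (length X + (n + length 0^d)))
               (trans (length-replicate N) (sym (length-replicate N))) ⟩
        length 1^N + (length X + (length 1^N + length 0^d))
          ≡⟨ rearrange (length 1^N) (length X) (length 0^d) ⟩
        length 1^N + (length 0^d + (length 1^N + length X))
          ≡⟨ length-++⁴ 1^N 0^d 1^N X ⟨
        length (1^N ++ 0^d ++ 1^N ++ X)
          ≡⟨ cong (λ t → length (1^N ++ t)) (++-assoc 0^d 1^N X) ⟨
        length v ∎
        where
        open ≡-Reasoning

        length-++⁴ : ∀ (p q r s : Word) → length (p ++ q ++ r ++ s) ≡ length p + (length q + (length r + length s))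
        length-++⁴ p q r s = trans (length-++ p)
          (cong (length p +_) (trans (length-++ q) (cong (length q +_) (length-++ r))))

        rearrange : ∀ n x k → n + (x + (n + k)) ≡ n + (k + (n + x))
        rearrange = solve-∀

      -- As N is 2 + m, `suc (2 * N ∸ 1)` computes to `2 * N`, where the chain ends.
      counts : ∣ u ∣[ 0F ] ≡ suc (2 * N ∸ 1) + ∣ v ∣[ 0F ]
      counts = begin
        ∣ u ∣[ 0F ]
          ≡⟨ ∣++∣⁴ 0^N X 0^N 0^d ⟩
        ∣ 0^N ∣[ 0F ] + (∣ X ∣[ 0F ] + (∣ 0^N ∣[ 0F ] + ∣ 0^d ∣[ 0F ]))
          ≡⟨ cong (λ n → n + (∣ X ∣[ 0F ] + (n + ∣ 0^d ∣[ 0F ]))) (∣0^∣₀ N) ⟩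
        N + (∣ X ∣[ 0F ] + (N + ∣ 0^d ∣[ 0F ]))
          -- The summands 0 are placeholders for the number of zeros in 1^N, inserted in the next
          -- step.
          ≡⟨ rearrange N ∣ X ∣[ 0F ] ∣ 0^d ∣[ 0F ] ⟩
        2 * N + (0 + (∣ 0^d ∣[ 0F ] + (0 + ∣ X ∣[ 0F ])))
          ≡⟨ cong (λ n → 2 * N + (n + (∣ 0^d ∣[ 0F ] + (n + ∣ X ∣[ 0F ])))) (∣1^∣₀ N) ⟨
        2 * N + (∣ 1^N ∣[ 0F ] + (∣ 0^d ∣[ 0F ] + (∣ 1^N ∣[ 0F ] + ∣ X ∣[ 0F ])))
          ≡⟨ cong (2 * N +_) (∣++∣⁴ 1^N 0^d 1^N X) ⟨
        2 * N + ∣ 1^N ++ 0^d ++ 1^N ++ X ∣[ 0F ]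
          ≡⟨ cong (λ t → 2 * N + ∣ 1^N ++ t ∣[ 0F ]) (++-assoc 0^d 1^N X) ⟨
        2 * N + ∣ v ∣[ 0F ] ∎
        where
        open ≡-Reasoning

        ∣++∣⁴ : ∀ p q r s → ∣ p ++ q ++ r ++ s ∣[ 0F ] ≡
          ∣ p ∣[ 0F ] + (∣ q ∣[ 0F ] + (∣ r ∣[ 0F ] + ∣ s ∣[ 0F ]))
        ∣++∣⁴ p q r s = trans (∣++∣ p (q ++ r ++ s) 0F)
          (cong (∣ p ∣[ 0F ] +_) (trans (∣++∣ q (r ++ s) 0F) (cong (∣ q ∣[ 0F ] +_) (∣++∣ r s 0F))))

        rearrange : ∀ n x k → n + (x + (n + k)) ≡ 2 * n + (0 + (k + (0 + x)))
        rearrange = solve-∀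

proposition4p6 : (N : ℕ) .{{_ : NonZero N}} → 2 ≤ N → (x : UnitIrrational) →
    (∀ (ω̂ : InfiniteWord) → IsDualNCFSequence N x ω̂ → ¬ Balanced 1 ω̂) ×
    (∀ (ω : InfiniteWord) → IsNCFSequence N x ω → ¬ Balanced (2 * N ∸ 1) ω)
-- Matching on 2 ≤ N exhibits N as 2 + m, the form required by `Blocks`.
proposition4p6 N@(suc (suc m)) {{nz}} (s≤s (s≤s z≤n)) x =
  (λ ω̂ → dual-unbalanced (digit N {{nz}} x) (N≤digit N {{nz}} x) {ω̂}) ,
  (λ ω → unbalanced-2N∸1 (digit N {{nz}} x) (N≤digit N {{nz}} x) {ω})
  where open Blocks m using (dual-unbalanced; unbalanced-2N∸1)
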